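{- Let $\kappa$, $\theta$ and $\lambda$ be infinite cardinals with $\operatorname{cf}(\lambda)=\theta$, let $D$ be a $(\kappa,\theta)$-weakly normal ultrafilter on $\kappa$, and assume that $\lambda$ is $\kappa$-strong. Then there is a sequence of cardinals $\bar\lambda=\langle\lambda_i : i<\kappa\rangle$ such that $\lambda=\lim_D(\bar\lambda)$ and $\left|\prod_{i<\kappa}\lambda_i/D\right|=\lambda$.
   Context: A cardinal $\lambda$ is $\kappa$-strong if $|\alpha|^{\kappa}<\lambda$ for every ordinal $\alpha<\lambda$. Regressive functions: for $g:\kappa\to\theta$, a function $f:\kappa\to\theta$ is $(\kappa,g)$-regressive if $f(i)<g(i)$ for every $i<\kappa$ with $g(i)>0$. Weak normality: let $D$ be an ultrafilter on $\kappa$ and $g:\kappa\to\theta$. $D$ is $(\kappa,g)$-weakly normal if (i) for every $\epsilon<\theta$, $\{i<\kappa: g(i)\ge\epsilon\}\in D$; and (ii) for every $(\kappa,g)$-regressive $f:\kappa\to\theta$ there is $j_f<\theta$ such that $\{i<\kappa: f(i)<j_f\}\in D$. $D$ is $(\kappa,\theta)$-weakly normal if it is $(\kappa,g)$-weakly normal for some $g:\kappa\to\theta$. Limit along $D$: for a sequence $\bar\lambda=\langle\lambda_i:i<\kappa\rangle$ of cardinals, $\lim_D(\bar\lambda)$ is the unique cardinal $\mu$ such that $\{i<\kappa:\beta<\lambda_i\le\mu\}\in D$ for every $\beta<\mu$. $\prod_{i<\kappa}\lambda_i/D$ is the ultraproduct of the sets $\lambda_i$ modulo $D$. -}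

module Defs where

open import Data.Empty.Polymorphic using (⊥)
open import Data.Nat using (ℕ)
open import Data.Product using (Σ; ∃; _×_; _,_; proj₁)
open import Data.Sum using (_⊎_)
open import Data.Unit.Polymorphic using (⊤; tt)
open import Function.Base using (_on_)
open import Function.Bundles using (Injection; Bijection; _↣_; _⤖_)
open import Induction.WellFounded using (WellFounded)
open import Level using (Level; suc)
open import Relation.Binary.Bundles using (Setoid)
open import Relation.Binary.Core using (Rel)
open import Relation.Binary.Definitions using (Irrelevant; Trichotomous; tri<; tri≈; tri>)
open import Relation.Binary.Morphism.Structures using (IsOrderIsomorphism)
open import Relation.Binary.PropositionalEquality
  using (_≡_; refl; sym; trans; cong; isEquivalence; setoid; _→-setoid_)
open import Relation.Binary.Structures using (IsStrictTotalOrder)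
open import Relation.Binary.Structures.Biased using (isStrictTotalOrderᶜ)
open import Relation.Nullary using (¬_)
open import Relation.Unary using (Pred; _⊆_; _∩_; ∁)
import Relation.Binary.Construct.On as On
import Relation.Binary.Construct.StrictToNonStrict as NonStrict

private
  variable
    ℓ : Level

-- An ordinal is represented by a well-ordered type.  The elements of the
-- carrier stand for the smaller ordinals.  Irrelevance of _<_ makes two
-- elements of an initial segment equal as soon as their underlying elements
-- are, so that segments carry no spurious copies of points.
record Ordinal (ℓ : Level) : Set (suc ℓ) where
  infix 4 _<_ _≤_
  field
    Carrier            : Set ℓ
    _<_                : Rel Carrier ℓ
    isStrictTotalOrder : IsStrictTotalOrder _≡_ _<_
    wellFounded        : WellFounded _<_
    irrelevant         : Irrelevant _<_

  open IsStrictTotalOrder isStrictTotalOrder public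
    using (compare) renaming (trans to <-trans)

  _≤_ : Rel Carrier ℓ
  _≤_ = NonStrict._≤_ _≡_ _<_

open Ordinal using (Carrier)

infix 9 _↓_
_↓_ : (α : Ordinal ℓ) → Carrier α → Ordinal ℓ
α ↓ a = record
  { Carrier            = Seg
  ; _<_                = α._<_ on proj₁
  ; isStrictTotalOrder = isStrictTotalOrderᶜ record
      { isEquivalence = isEquivalence
      ; trans         = α.<-trans
      ; compare       = cmp
      }
  ; wellFounded        = On.wellFounded proj₁ α.wellFounded
  ; irrelevant         = α.irrelevant
  }
  where
  module α = Ordinal α

  Seg : Set _
  Seg = Σ (Carrier α) (α._< a)

  seg-≡ : {x y : Seg} → proj₁ x ≡ proj₁ y → x ≡ y
  seg-≡ {x , p} {.x , q} refl = cong (x ,_) (α.irrelevant p q)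

  cmp : Trichotomous _≡_ (α._<_ on proj₁)
  cmp x y with α.compare (proj₁ x) (proj₁ y)
  ... | tri< x<y x≢y x≯y = tri< x<y (λ e → x≢y (cong proj₁ e)) x≯y
  ... | tri≈ x≮y x≡y x≯y = tri≈ x≮y (seg-≡ x≡y) x≯y
  ... | tri> x≮y x≢y x>y = tri> x≮y (λ e → x≢y (cong proj₁ e)) x>y

infix 4 _≅ₒ_ _<ₒ_ _≤ₒ_

_≅ₒ_ : Rel (Ordinal ℓ) ℓ
α ≅ₒ β = ∃ (IsOrderIsomorphism _≡_ _≡_ (Ordinal._<_ α) (Ordinal._<_ β))

_<ₒ_ : Rel (Ordinal ℓ) ℓ
α <ₒ β = ∃ λ b → α ≅ₒ β ↓ b

_≤ₒ_ : Rel (Ordinal ℓ) ℓ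
α ≤ₒ β = α <ₒ β ⊎ α ≅ₒ β

-- Cardinals are initial ordinals, so finite cardinals (including 0) occur too.
record Cardinal (ℓ : Level) : Set (suc ℓ) where
  field
    ordinal : Ordinal ℓ
    initial : ∀ β → β <ₒ ordinal → ¬ (Carrier β ⤖ Carrier ordinal)

open Cardinal public using (ordinal)

⟨_⟩ : Cardinal ℓ → Set ℓ
⟨ κ ⟩ = Carrier (ordinal κ)

Infinite : Pred (Cardinal ℓ) ℓ
Infinite κ = ℕ ↣ ⟨ κ ⟩

-- Function sets and ultraproducts are compared as setoids, because Agda has
-- neither function extensionality nor quotient types.

infix 4 _≼_ _≺_ ∣_∣≈_

_≼_ : Rel (Setoid ℓ ℓ) ℓ
S ≼ T = Injection S T

_≺_ : Rel (Setoid ℓ ℓ) ℓ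
S ≺ T = S ≼ T × ¬ (T ≼ S)

∣_∣≈_ : Setoid ℓ ℓ → Cardinal ℓ → Set ℓ
∣ S ∣≈ μ = Bijection S (setoid ⟨ μ ⟩)

-- |α|^κ is the cardinality of the set of functions κ → α.
Strong : Cardinal ℓ → Cardinal ℓ → Set (suc ℓ)
Strong κ μ = ∀ α → α <ₒ ordinal μ → (⟨ κ ⟩ →-setoid Carrier α) ≺ setoid ⟨ μ ⟩

CofinalMap : Ordinal ℓ → Ordinal ℓ → Set ℓ
CofinalMap α β =
  Σ (Carrier α → Carrier β) λ h → ∀ y → ∃ λ x → Ordinal._≤_ β y (h x)

-- IsCofinality μ θ says cf(μ) = θ: θ is the least ordinal that maps cofinally
-- into μ.
IsCofinality : Cardinal ℓ → Cardinal ℓ → Set (suc ℓ)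
IsCofinality μ θ =
  CofinalMap (ordinal θ) (ordinal μ) ×
  (∀ β → β <ₒ ordinal θ → ¬ CofinalMap β (ordinal μ))

record Ultrafilter (A : Set ℓ) : Set (suc ℓ) where
  infix 4 _∋_
  field
    _∋_    : Pred (Pred A ℓ) ℓ
    whole  : _∋_ (λ _ → ⊤)
    proper : ¬ (_∋_ (λ _ → ⊥))
    upward : ∀ {U V} → U ⊆ V → _∋_ U → _∋_ V
    meet   : ∀ {U V} → _∋_ U → _∋_ V → _∋_ (U ∩ V)
    ultra  : ∀ U → _∋_ U ⊎ _∋_ (∁ U)

open Ultrafilter using (_∋_)

module _ {A : Set ℓ} (θ : Cardinal ℓ) where

  open Ordinal (ordinal θ) using (_<_; _≤_)

  -- The premise ∃ λ j → j < g i expresses g(i) > 0.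
  Regressive : (g f : A → ⟨ θ ⟩) → Set ℓ
  Regressive g f = ∀ i → (∃ λ j → j < g i) → f i < g i

  record WeaklyNormalFor (D : Ultrafilter A) (g : A → ⟨ θ ⟩) : Set ℓ where
    field
      unbounded : ∀ ε → D ∋ (λ i → ε ≤ g i)
      pressing  : ∀ f → Regressive g f → ∃ λ j → D ∋ (λ i → f i < j)

  WeaklyNormal : Ultrafilter A → Set ℓ
  WeaklyNormal D = ∃ (WeaklyNormalFor D)

-- IsLimit D μs μ says lim_D μs = μ.  At most one nonzero μ has this property:
-- if μ < ν both had it, taking β = μ for ν would put two disjoint sets in D.
-- For μ = 0 it holds vacuously.
IsLimit : {A : Set ℓ} → Ultrafilter A → (A → Cardinal ℓ) → Cardinal ℓ → Set (suc ℓ)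
IsLimit D μs μ =
  ∀ β → β <ₒ ordinal μ →
  D ∋ (λ i → β <ₒ ordinal (μs i) × ordinal (μs i) ≤ₒ ordinal μ)

Ultraproduct : {A : Set ℓ} → (A → Set ℓ) → Ultrafilter A → Setoid ℓ ℓ
Ultraproduct {A = A} X D = record
  { Carrier       = (i : A) → X i
  ; _≈_           = λ f g → D ∋ (λ i → f i ≡ g i)
  ; isEquivalence = record
      { refl  = upward (λ _ → refl) whole
      ; sym   = upward sym
      ; trans = λ p q → upward (λ (e , e′) → trans e e′) (meet p q)
      }
  }
  where open Ultrafilter D using (whole; upward; meet)

{-# OPTIONS --safe #-}
module Submission where

-- Strength of Λ makes |b × κ| < Λ for b < Λ.  As κ → θ → Λ is cofinal, Λ is
-- therefore a limit cardinal, and there is a continuous sequence s of cardinals,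
-- cofinal in Λ and indexed by θ.  Put λ_i = s (g i).  Continuity
-- attaches to f ∈ ∏ λ_i a regressive function picking, below g i, an index of a
-- term of s above f i; by weak normality f is bounded by a single s t modulo D,
-- so its class is coded by a function κ → s t, hence by a pair in Λ × κ.  Every
-- initial segment of Λ × κ, ordered lexicographically, has size < Λ, so
-- collapsing the codes gives an injection into Λ; it is onto because Λ embeds
-- diagonally in the ultraproduct.

open import Defs
open import Axiom.ExcludedMiddle using (ExcludedMiddle)
open import Data.Empty using (⊥-elim)
open import Data.Product using (∃; _×_; _,_; proj₁; proj₂; Σ)
open import Data.Product.Relation.Binary.Lex.Strict using (×-Lex; ×-wellFounded)
open import Data.Sum using (_⊎_; inj₁; inj₂; [_,_])
open import Data.Unit.Polymorphic using (⊤; tt)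
open import Function.Base using (_∘_)
open import Function.Bundles using (Injection; Bijection; _↣_; mk↣)
open import Function.Construct.Composition using (injection)
open import Function.Definitions using (Injective)
open import Function.Properties.Bijection using (⤖⇒↔)
open import Function.Properties.Inverse using (↔⇒↣; ↔-sym)
open import Induction.WellFounded using (WellFounded; WfRec; module All; module FixPoint)
open import Level using (Level)
open import Relation.Binary.Bundles using (Setoid)
open import Relation.Binary.Core using (Rel)
open import Relation.Binary.Definitions using (tri<; tri≈; tri>)
open import Relation.Binary.Morphism.Construct.Composition using (isOrderIsomorphism)
import Relation.Binary.Morphism.Construct.Identity as Identity
open import Relation.Binary.Morphism.Structures using (IsOrderIsomorphism)
open import Relation.Binary.PropositionalEquality
  using (_≡_; refl; sym; trans; cong; subst; setoid; _→-setoid_)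
open import Relation.Binary.Structures using (IsStrictTotalOrder)
open import Relation.Nullary using (¬_; yes; no)
open import Relation.Unary using (Pred; _⊆_)

open Ordinal using (Carrier)

private
  variable
    ℓ : Level

-- Initial segments of an ordinal.

module OrdinalProperties (α : Ordinal ℓ) where
  open Ordinal α using (_<_; _≤_; compare; <-trans; irrelevant)

  connex : ∀ x y → x < y ⊎ x ≡ y ⊎ y < x
  connex x y with compare x y
  ... | tri< x<y _ _ = inj₁ x<y
  ... | tri≈ _ x≡y _ = inj₂ (inj₁ x≡y)
  ... | tri> _ _ y<x = inj₂ (inj₂ y<x)

  <-irrefl : ∀ {x} → ¬ (x < x)
  <-irrefl = IsStrictTotalOrder.irrefl (Ordinal.isStrictTotalOrder α) refl

  ≤-<-trans : ∀ {x y z} → x ≤ y → y < z → x < z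
  ≤-<-trans (inj₁ x<y)  y<z = <-trans x<y y<z
  ≤-<-trans (inj₂ refl) y<z = y<z

  <-≤-trans : ∀ {x y z} → x < y → y ≤ z → x < z
  <-≤-trans x<y (inj₁ y<z)  = <-trans x<y y<z
  <-≤-trans x<y (inj₂ refl) = x<y

  ≤⇒≯ : ∀ {x y} → x ≤ y → ¬ (y < x)
  ≤⇒≯ x≤y y<x = <-irrefl (≤-<-trans x≤y y<x)

  ≮⇒≥ : ∀ {x y} → ¬ (x < y) → y ≤ x
  ≮⇒≥ {x} {y} x≮y with connex x y
  ... | inj₁ x<y        = ⊥-elim (x≮y x<y)
  ... | inj₂ (inj₁ x≡y) = inj₂ (sym x≡y)
  ... | inj₂ (inj₂ y<x) = inj₁ y<x

  ≰⇒> : ∀ {x y} → ¬ (x ≤ y) → y < x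
  ≰⇒> {x} {y} x≰y with connex x y
  ... | inj₁ x<y        = ⊥-elim (x≰y (inj₁ x<y))
  ... | inj₂ (inj₁ x≡y) = ⊥-elim (x≰y (inj₂ x≡y))
  ... | inj₂ (inj₂ y<x) = y<x

  upperBound : ∀ x y → ∃ λ z → x ≤ z × y ≤ z
  upperBound x y with connex x y
  ... | inj₁ x<y        = y , inj₁ x<y , inj₂ refl
  ... | inj₂ (inj₁ x≡y) = y , inj₂ x≡y , inj₂ refl
  ... | inj₂ (inj₂ y<x) = x , inj₂ refl , inj₁ y<x

  Seg : Carrier α → Set _
  Seg a = Carrier (α ↓ a)

  seg-≡ : ∀ {a} {x y : Seg a} → proj₁ x ≡ proj₁ y → x ≡ y
  seg-≡ {x = x , p} {.x , q} refl = cong (x ,_) (irrelevant p q)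

  seg-⊆ : ∀ {a b} → a ≤ b → Seg a ↣ Seg b
  seg-⊆ a≤b = mk↣ {to = λ (x , x<a) → x , <-≤-trans x<a a≤b} (seg-≡ ∘ cong proj₁)

  seg-seg : ∀ {a} (b : Seg a) → Carrier ((α ↓ a) ↓ b) ↣ Seg (proj₁ b)
  seg-seg b = mk↣ {to = λ (x , x<b) → proj₁ x , x<b} λ e → nested (cong proj₁ e)
    where
    nested : {x y : Carrier ((α ↓ _) ↓ b)} → proj₁ (proj₁ x) ≡ proj₁ (proj₁ y) → x ≡ y
    nested {(x , p) , q} {(.x , p′) , q′} refl with irrelevant p p′ | irrelevant q q′
    ... | refl | refl = refl

  ↓-<ₒ : ∀ a → α ↓ a <ₒ α
  ↓-<ₒ a = a , _ , Identity.isOrderIsomorphism _ _ refl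

  <ₒ-↓ : ∀ {β a} → (β<α : β <ₒ α) → proj₁ β<α < a → β <ₒ α ↓ a
  <ₒ-↓ {β} {a} (b , _ , iso) b<a =
    (b , b<a) , _ , isOrderIsomorphism trans iso nest
    where
    nest : IsOrderIsomorphism _≡_ _≡_ (Ordinal._<_ (α ↓ b)) (Ordinal._<_ ((α ↓ a) ↓ (b , b<a)))
             (λ (x , x<b) → (x , <-trans x<b b<a) , x<b)
    nest = record
      { isOrderMonomorphism = record
          { isOrderHomomorphism = record { cong = cong _ ; mono = λ p → p }
          ; injective = λ e → seg-≡ (cong (proj₁ ∘ proj₁) e)
          ; cancel    = λ p → p
          }
      ; surjective = λ ((x , x<a) , x<b) →
          (x , x<b) , λ { refl → cong (λ p → (x , p) , x<b) (irrelevant _ _) }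
      }

  -- Phrased with injections so that it composes with inclusions of segments; `cardinal` recovers
  -- the condition on bijections.
  IsInitial : Carrier α → Set _
  IsInitial c = ∀ x → x < c → ¬ (Seg c ↣ Seg x)

  cardinal : ∀ {c} → IsInitial c → Cardinal _
  cardinal {c} init = record
    { ordinal = α ↓ c
    ; initial = λ { β (b , f , iso) β⤖c →
        init (proj₁ b) (proj₂ b)
          (injection (↔⇒↣ (↔-sym (⤖⇒↔ β⤖c)))
            (injection (mk↣ (IsOrderIsomorphism.injective iso)) (seg-seg b))) }
    }

-- Least elements in a well-order.

module Minimum
  (em : ExcludedMiddle ℓ) {W : Set ℓ} {_⊏_ : Rel W ℓ} (wf : WellFounded _⊏_)
  (connex : ∀ v w → v ⊏ w ⊎ v ≡ w ⊎ w ⊏ v) (default : W)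
  where

  private
    IsMin : Pred W ℓ → Pred W ℓ
    IsMin P m = P m × (∀ w → P w → ¬ (w ⊏ m))

    minimal : (P : Pred W ℓ) → ∀ w → P w → ∃ (IsMin P)
    minimal P = All.wfRec wf ℓ (λ w → P w → ∃ (IsMin P)) step
      where
      step : ∀ w → WfRec _⊏_ (λ w → P w → ∃ (IsMin P)) w → P w → ∃ (IsMin P)
      step w rec pw with em {P = ∃ λ v → v ⊏ w × P v}
      ... | yes (v , v⊏w , pv) = rec v⊏w pv
      ... | no  none           = w , pw , λ v pv v⊏w → none (v , v⊏w , pv)

  -- Junk value: the default element if P is empty.
  min : Pred W ℓ → W
  min P with em {P = ∃ P}
  ... | yes (w , pw) = proj₁ (minimal P w pw)
  ... | no  _        = default

  private
    min-isMin : (P : Pred W ℓ) → ∃ P → IsMin P (min P)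
    min-isMin P ex with em {P = ∃ P}
    ... | yes (w , pw) = proj₂ (minimal P w pw)
    ... | no  none     = ⊥-elim (none ex)

  min-∈ : (P : Pred W ℓ) → ∃ P → P (min P)
  min-∈ P ex = proj₁ (min-isMin P ex)

  min-≮ : (P : Pred W ℓ) → ∀ {w} → P w → ¬ (w ⊏ min P)
  min-≮ P pw = proj₂ (min-isMin P (_ , pw)) _ pw

  -- Lets the recursion in `Collapse` unfold and makes `invariantCode` constant on classes. Each
  -- minimum belongs to both predicates, so neither precedes the other.
  min-cong : {P Q : Pred W ℓ} → P ⊆ Q → Q ⊆ P → min P ≡ min Q
  min-cong {P} {Q} P⊆Q Q⊆P with em {P = ∃ P} | em {P = ∃ Q}
  ... | yes (v , pv) | no none      = ⊥-elim (none (v , P⊆Q pv))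
  ... | no none      | yes (w , qw) = ⊥-elim (none (w , Q⊆P qw))
  ... | no _         | no _         = refl
  ... | yes (v , pv) | yes (w , qw) with minimal P v pv | minimal Q w qw
  ...   | m , pm , m≮ | n , qn , n≮ with connex m n
  ...     | inj₁ m⊏n        = ⊥-elim (n≮ m (P⊆Q pm) m⊏n)
  ...     | inj₂ (inj₁ m≡n) = m≡n
  ...     | inj₂ (inj₂ n⊏m) = ⊥-elim (m≮ n (Q⊆P qn) n⊏m)

  -- A code that only separates the classes is made invariant by passing to the
  -- least code of a class.
  invariantCode : (S : Setoid ℓ ℓ) (code : Setoid.Carrier S → W) →
                  (∀ {f g} → code f ≡ code g → Setoid._≈_ S f g) → S ≼ setoid W
  invariantCode S code separates = record
    { to        = λ f → min (Codes f)
    ; cong      = λ f≈g → min-cong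
        (λ (h , f≈h , e) → h , S.trans (S.sym f≈g) f≈h , e)
        (λ (h , g≈h , e) → h , S.trans f≈g g≈h , e)
    ; injective = λ {f} {g} e →
        let (f′ , f≈f′ , ef) = codes-min f
            (g′ , g≈g′ , eg) = codes-min g
        in S.trans f≈f′ (S.trans (separates (trans ef (trans e (sym eg)))) (S.sym g≈g′))
    }
    where
    module S = Setoid S

    Codes : S.Carrier → Pred W ℓ
    Codes f w = ∃ λ g → f S.≈ g × code g ≡ w

    codes-min : ∀ f → Codes f (min (Codes f))
    codes-min f = min-∈ (Codes f) (code f , f , S.refl , refl)

-- Collapsing a well-ordered set of codes into an ordinal.

module Collapse
  (em : ExcludedMiddle ℓ) (α : Ordinal ℓ) (default : Carrier α)
  {W : Set ℓ} {_⊏_ : Rel W ℓ} (wf : WellFounded _⊏_)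
  (connex : ∀ v w → v ⊏ w ⊎ v ≡ w ⊎ w ⊏ v)
  (small : ∀ w (e : Carrier α → W) → Injective _≡_ _≡_ e → ¬ (∀ y → e y ⊏ w))
  (S : Setoid ℓ ℓ) (encoding : S ≼ setoid W)
  where
  open Ordinal α using (_<_; _≤_; wellFounded)
  open OrdinalProperties α renaming (connex to <-connex)
  open Minimum em wellFounded <-connex default
  open Injection encoding using () renaming (to to code; cong to code-cong; injective to code-injective)

  private
    -- Only codes use up values, so on them `collapse` is the Mostowski collapse of the range of
    -- `code`; other points of `W` are skipped.
    Taken : ∀ w → WfRec _⊏_ (λ _ → Carrier α) w → Pred (Carrier α) ℓ
    Taken w rec y = ∃ λ f → Σ (code f ⊏ w) λ p → rec p ≡ y

    step : ∀ w → WfRec _⊏_ (λ _ → Carrier α) w → Carrier α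
    step w rec = min (λ y → ¬ Taken w rec y)

    step-ext : ∀ w {r r′ : WfRec _⊏_ (λ _ → Carrier α) w} →
               (∀ {v} v⊏w → r {v} v⊏w ≡ r′ v⊏w) → step w r ≡ step w r′
    step-ext w eq = min-cong
      (λ free (f , p , e) → free (f , p , trans (eq p) e))
      (λ free (f , p , e) → free (f , p , trans (sym (eq p)) e))

    collapse : W → Carrier α
    collapse = All.wfRec wf ℓ (λ _ → Carrier α) step

    Free : W → Pred (Carrier α) ℓ
    Free w y = ¬ Taken w (λ {v} _ → collapse v) y

    collapse-unfold : ∀ w → collapse w ≡ min (Free w)
    collapse-unfold w = FixPoint.unfold-wfRec wf (λ _ → Carrier α) step step-ext {w}

    -- Were every value taken, choosing for each value a smaller code that collapses to it would
    -- inject `α` into the segment below `w`, against `small`.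
    ∃-free : ∀ w → ∃ (Free w)
    ∃-free w with em {P = ∃ (Free w)}
    ... | yes ex = ex
    ... | no  none = ⊥-elim (small w (λ y → code (proj₁ (taken y)))
                       (λ {y} {y′} e → trans (sym (proj₂ (proj₂ (taken y))))
                          (trans (cong collapse e) (proj₂ (proj₂ (taken y′)))))
                       (λ y → proj₁ (proj₂ (taken y))))
      where
      taken : ∀ y → Taken w (λ {v} _ → collapse v) y
      taken y with em {P = Taken w (λ {v} _ → collapse v) y}
      ... | yes t = t
      ... | no  f = ⊥-elim (none (y , f))

    collapse-free : ∀ w → Free w (collapse w)
    collapse-free w = subst (Free w) (sym (collapse-unfold w)) (min-∈ (Free w) (∃-free w))

    collapse-≤ : ∀ w {y} → Free w y → collapse w ≤ y
    collapse-≤ w {y} free = subst (_≤ y) (sym (collapse-unfold w)) (≮⇒≥ (min-≮ (Free w) free))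

    collapseᶜ : Setoid.Carrier S → Carrier α
    collapseᶜ f = collapse (code f)

    collapseᶜ-injective : ∀ {f g} → collapseᶜ f ≡ collapseᶜ g → Setoid._≈_ S f g
    collapseᶜ-injective {f} {g} e with connex (code f) (code g)
    ... | inj₁ f⊏g        = ⊥-elim (collapse-free (code g) (f , f⊏g , e))
    ... | inj₂ (inj₁ f≡g) = code-injective f≡g
    ... | inj₂ (inj₂ g⊏f) = ⊥-elim (collapse-free (code f) (g , g⊏f , sym e))

  -- An omitted `b` is free at every stage, so leastness keeps all values below `b`; `S` would then
  -- embed in `Seg b`, against `large`.
  bijection : (∀ b → ¬ (S ≼ setoid (Seg b))) → Bijection S (setoid (Carrier α))
  bijection large = record
    { to        = collapseᶜ
    ; cong      = cong collapse ∘ code-cong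
    ; bijective = collapseᶜ-injective , λ b → let (f , e) = attained b in
        f , λ z≈f → trans (cong collapse (code-cong z≈f)) e
    }
    where
    attained : ∀ b → ∃ λ f → collapseᶜ f ≡ b
    attained b with em {P = ∃ λ f → collapseᶜ f ≡ b}
    ... | yes ex = ex
    ... | no  omitted = ⊥-elim (large b (record
      { to        = λ f → collapseᶜ f , below f
      ; cong      = λ f≈g → seg-≡ (cong collapse (code-cong f≈g))
      ; injective = collapseᶜ-injective ∘ cong proj₁
      }))
      where
      below : ∀ f → collapseᶜ f < b
      below f with collapse-≤ (code f) {b} (λ (g , _ , e) → omitted (g , e))
      ... | inj₁ lt = lt
      ... | inj₂ e  = ⊥-elim (omitted (f , e))

-- Consequences of cofinality and strength.

module Construction
  (em : ExcludedMiddle ℓ) (κ θ Λ : Cardinal ℓ)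
  (κ-infinite : Infinite κ) (θ-infinite : Infinite θ) (cof : IsCofinality Λ θ)
  (D : Ultrafilter ⟨ κ ⟩) (wn : WeaklyNormal θ D) (strong : Strong κ Λ)
  where
  open Ordinal (ordinal Λ) using (_<_; _≤_; <-trans; wellFounded)
  open OrdinalProperties (ordinal Λ)
  module θ where
    open Ordinal (ordinal θ) public
    open OrdinalProperties (ordinal θ) public
  module κ where
    open Ordinal (ordinal κ) public using (_<_; wellFounded)
    open OrdinalProperties (ordinal κ) public using (connex)
  open Ultrafilter using (_∋_)
  open Ultrafilter D using (upward; meet; proper)

  g : ⟨ κ ⟩ → ⟨ θ ⟩
  g = proj₁ wn

  open WeaklyNormalFor (proj₂ wn) using (unbounded; pressing)

  h : ⟨ θ ⟩ → ⟨ Λ ⟩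
  h = proj₁ (proj₁ cof)

  h-cofinal : ∀ y → ∃ λ t → y ≤ h t
  h-cofinal = proj₂ (proj₁ cof)

  i₀ : ⟨ κ ⟩
  i₀ = Injection.to κ-infinite 0

  inhabited : ∀ {U} → D ∋ U → ∃ U
  inhabited {U} D∋U with em {P = ∃ U}
  ... | yes ex = ex
  ... | no  none = ⊥-elim (proper (upward (λ {i} u → ⊥-elim (none (i , u))) D∋U))

  -- Minimality of `θ`: otherwise `f` would be a cofinal map from a smaller ordinal.
  bounded : ∀ t (f : θ.Seg t → ⟨ Λ ⟩) → ∃ λ b → ∀ x → f x < b
  bounded t f with em {P = ∃ λ b → ∀ x → f x < b}
  ... | yes ex = ex
  ... | no  none = ⊥-elim (proj₂ cof (ordinal θ ↓ t) (θ.↓-<ₒ t) (f , cofinal))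
    where
    cofinal : ∀ y → ∃ λ x → y ≤ f x
    cofinal y with em {P = ∃ λ x → y ≤ f x}
    ... | yes ex = ex
    ... | no  no-x = ⊥-elim (none (y , λ x → ≰⇒> λ y≤ → no-x (x , y≤)))

  θ-nontrivial : ∃ λ t → θ.Seg t
  θ-nontrivial with θ.connex (to 0) (to 1)
    where open Injection θ-infinite using (to)
  ... | inj₁ lt        = _ , _ , lt
  ... | inj₂ (inj₁ eq) with () ← Injection.injective θ-infinite eq
  ... | inj₂ (inj₂ gt) = _ , _ , gt

  Λ-unbounded : ∀ x → ∃ λ y → x < y
  Λ-unbounded x =
    let (t , j) = θ-nontrivial
        (y , x<y) = bounded t (λ _ → x)
    in y , x<y j

  bounded≤ : ∀ t (f : ⟨ θ ⟩ → ⟨ Λ ⟩) → ∃ λ b → ∀ j → j θ.≤ t → f j < b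
  bounded≤ t f =
    let (b₁ , <b₁) = bounded t (f ∘ proj₁)
        (b₂ , <b₂) = Λ-unbounded (f t)
        (b , b₁≤b , b₂≤b) = upperBound b₁ b₂
    in b , λ { j (inj₁ j<t) → <-≤-trans (<b₁ (j , j<t)) b₁≤b
             ; j (inj₂ refl) → <-≤-trans <b₂ b₂≤b }

  -- If `t` were the last index, `bounded≤` would bound the cofinal map `h`.
  θ-unbounded : ∀ t → ∃ λ t′ → t θ.< t′
  θ-unbounded t =
    let (b , h<b) = bounded≤ t h
        (t′ , b≤ht′) = h-cofinal b
    in t′ , θ.≰⇒> λ t′≤t → ≤⇒≯ b≤ht′ (h<b t′ t′≤t)

  -- (y , k) ↦ the function with value y at k and b elsewhere embeds b × κ into
  -- κ → b′ for any b′ > b, so strength of Λ bounds |b × κ|.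
  no-embedding : ∀ b (e : ⟨ Λ ⟩ → ⟨ Λ ⟩ × ⟨ κ ⟩) → Injective _≡_ _≡_ e →
                 ¬ (∀ y → proj₁ (e y) < b)
  no-embedding b e e-injective e<b =
    proj₂ (strong (ordinal Λ ↓ b′) (↓-<ₒ b′)) record
      { to        = λ y → spike (e y) (e<b y)
      ; cong      = λ { refl _ → refl }
      ; injective = λ eq → e-injective (spike-injective _ _ _ _ λ i → cong proj₁ (eq i))
      }
    where
    b′ : ⟨ Λ ⟩
    b′ = proj₁ (Λ-unbounded b)

    b<b′ : b < b′
    b<b′ = proj₂ (Λ-unbounded b)

    spike : (w : ⟨ Λ ⟩ × ⟨ κ ⟩) → proj₁ w < b → ⟨ κ ⟩ → Seg b′
    spike (y , k) y<b i with em {P = i ≡ k}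
    ... | yes _ = y , <-trans y<b b<b′
    ... | no  _ = b , b<b′

    spike-injective : ∀ w w′ p p′ →
      (∀ i → proj₁ (spike w p i) ≡ proj₁ (spike w′ p′ i)) → w ≡ w′
    spike-injective (y , k) (y′ , k′) p p′ eq
      with em {P = k ≡ k} | em {P = k ≡ k′} | eq k
    ... | no k≢k | _        | _    = ⊥-elim (k≢k refl)
    ... | yes _  | yes refl | refl = refl
    -- The filler `b` lies above every value at a spike, so the spikes cannot sit at different
    -- places.
    ... | yes _  | no _     | refl = ⊥-elim (<-irrefl p)

  no-segment-embedding : ∀ b → ¬ (⟨ Λ ⟩ ↣ Seg b)
  no-segment-embedding b f = no-embedding b (λ y → proj₁ (to y) , i₀)
    (λ e → injective (seg-≡ (cong proj₁ e))) (λ y → proj₂ (to y))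
    where open Injection f using (to; injective)

  -- If no initial point exceeded x, all segments would embed in x, and a
  -- cofinal κ-sequence of such embeddings would embed Λ in x × κ.
  large-segment : ∀ x → ∃ λ c → ¬ (Seg c ↣ Seg x)
  large-segment x with em {P = ∃ λ c → ¬ (Seg c ↣ Seg x)}
  ... | yes ex = ex
  ... | no  none = ⊥-elim (no-embedding x e e-injective e<x)
    where
    shrink : ∀ c → Seg c ↣ Seg x
    shrink c with em {P = Seg c ↣ Seg x}
    ... | yes f = f
    ... | no ¬f = ⊥-elim (none (c , ¬f))

    B : ⟨ κ ⟩ → ⟨ Λ ⟩
    -- These points are cofinal in `Λ`: `h` is cofinal, and `g` is cofinal in `θ` because sets in
    -- `D` are nonempty.
    B i = proj₁ (bounded≤ (g i) h)

    index : ⟨ Λ ⟩ → ⟨ κ ⟩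
    index y = proj₁ (inhabited (unbounded (proj₁ (h-cofinal y))))

    below : ∀ y → y < B (index y)
    below y = ≤-<-trans (proj₂ (h-cofinal y))
      (proj₂ (bounded≤ (g (index y)) h) _ (proj₂ (inhabited (unbounded (proj₁ (h-cofinal y))))))

    into : ∀ i → Seg (B i) → Seg x
    into i = Injection.to (shrink (B i))

    e : ⟨ Λ ⟩ → ⟨ Λ ⟩ × ⟨ κ ⟩
    -- The images of the embeddings may overlap, so the second coordinate records which one was
    -- used.
    e y = proj₁ (into (index y) (y , below y)) , index y

    into-injective : ∀ {i i′ y y′} (p : y < B i) (p′ : y′ < B i′) → i ≡ i′ →
                     proj₁ (into i (y , p)) ≡ proj₁ (into i′ (y′ , p′)) → y ≡ y′
    into-injective {i} _ _ refl eq = cong proj₁ (Injection.injective (shrink (B i)) (seg-≡ eq))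

    e-injective : Injective _≡_ _≡_ e
    e-injective {y} {y′} eq = into-injective (below y) (below y′) (cong proj₂ eq) (cong proj₁ eq)

    e<x : ∀ y → proj₁ (e y) < x
    e<x y = proj₂ (into (index y) (y , below y))

  -- Successor cardinals and a continuous cofinal sequence.

  module Minθ = Minimum em θ.wellFounded θ.connex (g i₀)
  open Minimum em wellFounded connex (h (g i₀)) using (min; min-∈; min-≮)

  infix 8 _⁺
  -- The least cardinal above the size of `x`, as a point of `Λ`; `large-segment` ensures that it
  -- exists.
  _⁺ : ⟨ Λ ⟩ → ⟨ Λ ⟩
  x ⁺ = min (λ c → ¬ (Seg c ↣ Seg x))

  ⁺-large : ∀ x → ¬ (Seg (x ⁺) ↣ Seg x)
  ⁺-large x = min-∈ _ (large-segment x)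

  <⁺ : ∀ x → x < x ⁺
  <⁺ x = ≰⇒> λ x⁺≤x → ⁺-large x (seg-⊆ x⁺≤x)

  ⁺-initial : ∀ x → IsInitial (x ⁺)
  ⁺-initial x y y<x⁺ f with em {P = Seg y ↣ Seg x}
  ... | yes g = ⁺-large x (injection f g)
  ... | no ¬g = min-≮ _ ¬g y<x⁺

  t₀ : ⟨ θ ⟩
  t₀ = Minθ.min (λ _ → ⊤)

  t₀≤ : ∀ t → t₀ θ.≤ t
  t₀≤ t = θ.≮⇒≥ (Minθ.min-≮ (λ _ → ⊤) tt)

  -- The extra index t₀ matters only for t = t₀, where it keeps s t nonzero.
  Below : ⟨ θ ⟩ → Pred ⟨ θ ⟩ ℓ
  Below t j = j θ.< t ⊎ j ≡ t₀

  IsBound : ⟨ θ ⟩ → Pred ⟨ Λ ⟩ ℓ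
  IsBound t y = ∀ j → Below t j → h j ⁺ ≤ y

  -- The supremum of the `h j ⁺`. Apart from `t₀`, only indices strictly below `t` enter, which is
  -- what makes `pick` regressive.
  s : ⟨ θ ⟩ → ⟨ Λ ⟩
  s t = min (IsBound t)

  s-bound : ∀ t → IsBound t (s t)
  s-bound t = min-∈ (IsBound t) (proj₁ b , λ where
      j (inj₁ j<t)  → inj₁ (proj₂ b j (inj₁ j<t))
      j (inj₂ refl) → inj₁ (proj₂ b j (t₀≤ t)))
    where
    b : ∃ λ b → ∀ j → j θ.≤ t → h j ⁺ < b
    b = bounded≤ t (λ j → h j ⁺)

  s-approach : ∀ {t y} → y < s t → ∃ λ j → Below t j × y < h j ⁺
  s-approach {t} {y} y<s with em {P = ∃ λ j → Below t j × y < h j ⁺}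
  ... | yes ex = ex
  ... | no  none = ⊥-elim (min-≮ (IsBound t) (λ j b → ≮⇒≥ λ y< → none (j , b , y<)) y<s)

  -- A supremum of cardinals is a cardinal: `y` lies below some `h j ⁺`, whose segment is part of
  -- that of `s t`, and `h j ⁺` is initial.
  s-initial : ∀ t → IsInitial (s t)
  s-initial t y y<s f =
    let (j , j∈ , y<hj⁺) = s-approach y<s
    in ⁺-initial (h j) y y<hj⁺ (injection (seg-⊆ (s-bound t j j∈)) f)

  s-limit : ∀ y → D ∋ (λ i → y < s (g i))
  s-limit y =
    let (t , y≤ht) = h-cofinal y
        -- The index must pass `t` properly, because `Below` is strict.
        (t′ , t<t′) = θ-unbounded t
    in upward (λ t′≤gi → ≤-<-trans y≤ht (<-≤-trans (<⁺ (h t))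
         (s-bound _ t (inj₁ (θ.<-≤-trans t<t′ t′≤gi))))) (unbounded t′)

  Λs : ⟨ κ ⟩ → Cardinal ℓ
  Λs i = cardinal (s-initial (g i))

  base : ∀ t → Seg (s t)
  base t = h t₀ , <-≤-trans (<⁺ (h t₀)) (s-bound t t₀ (inj₂ refl))

  isLimit : IsLimit D Λs Λ
  isLimit β β<Λ =
    upward (λ {i} b<s → <ₒ-↓ {β} β<Λ b<s , inj₁ (↓-<ₒ (s (g i)))) (s-limit (proj₁ β<Λ))

  -- Coding the ultraproduct by pairs.

  Π/D : Setoid ℓ ℓ
  Π/D = Ultraproduct (λ i → ⟨ Λs i ⟩) D

  open Setoid Π/D using (_≈_) renaming (Carrier to Π)

  -- If f i < s (g i), then f i lies below h j ⁺ for some j < g i; pressing down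
  -- on j bounds f by a single s t.
  index : ∀ (f : Π) → ∃ λ k → D ∋ (λ i → proj₁ (f i) < s (g k))
  index f =
    let (j , D∋j) = pressing pick pick-regressive
        -- Above `t₀`, so that `g i` is not least for `D`-almost all `i`, as `pick-spec` needs.
        (t , t₀<t) = θ-unbounded t₀
        -- The bound is named by some `k` in `κ` and not by `j`, so that codes lie in `Λ × κ`, where
        -- `no-embedding` applies.
        (k , j≤gk) = inhabited (unbounded j)
    in k , upward (λ {i} (pick<j , t≤gi) →
              <-≤-trans (proj₂ (pick-spec i (t₀ , θ.<-≤-trans t₀<t t≤gi)))
                (s-bound (g k) (pick i) (inj₁ (θ.<-≤-trans pick<j j≤gk))))
            (meet D∋j (unbounded t))
    where
    approach : ∀ i → ∃ λ j → Below (g i) j × proj₁ (f i) < h j ⁺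
    approach i = s-approach (proj₂ (f i))

    pick : ⟨ κ ⟩ → ⟨ θ ⟩
    pick i = proj₁ (approach i)

    pick-spec : ∀ i → θ.Seg (g i) → pick i θ.< g i × proj₁ (f i) < h (pick i) ⁺
    pick-spec i (j , j<gi) with approach i
    ... | _ , inj₁ p<gi , lt = p<gi , lt
    -- The exceptional index `t₀` is also below `g i`, since `g i` has the smaller element `j`.
    ... | _ , inj₂ refl , lt = θ.≤-<-trans (t₀≤ j) j<gi , lt

    pick-regressive : Regressive θ g pick
    pick-regressive i j = proj₁ (pick-spec i j)

  -- An `f` is below `s t` only modulo `D`; the junk value `base t` elsewhere turns it into a
  -- function into the segment.
  truncate : ∀ t → ⟨ Λ ⟩ → Seg (s t)
  truncate t y with em {P = y < s t}
  ... | yes y<s = y , y<s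
  ... | no  _   = base t

  truncate-< : ∀ {t y} → y < s t → proj₁ (truncate t y) ≡ y
  truncate-< {t} {y} y<s with em {P = y < s t}
  ... | yes _   = refl
  ... | no  y≮s = ⊥-elim (y≮s y<s)

  functionCode : ∀ k → (⟨ κ ⟩ →-setoid Seg (s (g k))) ≼ setoid ⟨ Λ ⟩
  functionCode k = proj₁ (strong (ordinal Λ ↓ s (g k)) (↓-<ₒ _))

  codeAt : ⟨ κ ⟩ → Π → ⟨ Λ ⟩
  codeAt k f = Injection.to (functionCode k) λ i → truncate (g k) (proj₁ (f i))

  -- `k` and `k′` are variables so that their equality can be matched; in use both are computed by
  -- `index`. Truncation changes nothing on a set in `D`.
  codeAt-separates : ∀ {f f′ k k′} →
    D ∋ (λ i → proj₁ (f i) < s (g k)) → D ∋ (λ i → proj₁ (f′ i) < s (g k′)) →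
    k ≡ k′ → codeAt k f ≡ codeAt k′ f′ → f ≈ f′
  codeAt-separates {k = k} D∋ D∋′ refl eq = upward
    (λ {i} (f<s , f′<s) → seg-≡ (trans (sym (truncate-< f<s))
      (trans (cong proj₁ (Injection.injective (functionCode k) eq i)) (truncate-< f′<s))))
    (meet D∋ D∋′)

  code : Π → ⟨ Λ ⟩ × ⟨ κ ⟩
  code f = codeAt (proj₁ (index f)) f , proj₁ (index f)

  code-separates : ∀ {f f′} → code f ≡ code f′ → f ≈ f′
  code-separates {f} {f′} eq =
    codeAt-separates (proj₂ (index f)) (proj₂ (index f′)) (cong proj₂ eq) (cong proj₁ eq)

  -- The size of the ultraproduct.

  _⊏_ : Rel (⟨ Λ ⟩ × ⟨ κ ⟩) ℓ
  _⊏_ = ×-Lex _≡_ _<_ κ._<_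

  ⊏-wellFounded : WellFounded _⊏_
  ⊏-wellFounded = ×-wellFounded wellFounded κ.wellFounded

  ⊏-connex : ∀ v w → v ⊏ w ⊎ v ≡ w ⊎ w ⊏ v
  ⊏-connex (x , i) (y , j) with connex x y | κ.connex i j
  ... | inj₁ x<y         | _                = inj₁ (inj₁ x<y)
  ... | inj₂ (inj₂ y<x)  | _                = inj₂ (inj₂ (inj₁ y<x))
  ... | inj₂ (inj₁ refl) | inj₁ i<j         = inj₁ (inj₂ (refl , i<j))
  ... | inj₂ (inj₁ refl) | inj₂ (inj₁ refl) = inj₂ (inj₁ refl)
  ... | inj₂ (inj₁ refl) | inj₂ (inj₂ j<i)  = inj₂ (inj₂ (inj₂ (refl , j<i)))

  -- Predecessors of a pair starting with `b` have first coordinate at most `b`, so they lie in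
  -- `b′ × κ` for any `b′` above `b`.
  ⊏-small : ∀ w (e : ⟨ Λ ⟩ → ⟨ Λ ⟩ × ⟨ κ ⟩) → Injective _≡_ _≡_ e → ¬ (∀ y → e y ⊏ w)
  ⊏-small (b , _) e e-injective e⊏w =
    let (b′ , b<b′) = Λ-unbounded b
    in no-embedding b′ e e-injective λ y → ≤-<-trans ([ inj₁ , inj₂ ∘ proj₁ ] (e⊏w y)) b<b′

  -- Two images that agree modulo `D` agree at some `i` with `s (g i)` above both points, where
  -- neither is truncated.
  diagonal : setoid ⟨ Λ ⟩ ≼ Π/D
  diagonal = record
    { to        = λ y i → truncate (g i) y
    ; cong      = λ { refl → Setoid.refl Π/D }
    ; injective = λ {y} {y′} eq →
        let (i , e , y<s , y′<s) = inhabited (meet eq (meet (s-limit y) (s-limit y′)))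
        in trans (sym (truncate-< y<s)) (trans (cong proj₁ e) (truncate-< y′<s))
    }

  Π/D-size : ∣ Π/D ∣≈ Λ
  Π/D-size = bijection λ b f → no-segment-embedding b (injection diagonal f)
    where
    open Minimum em ⊏-wellFounded ⊏-connex (h t₀ , i₀) using (invariantCode)
    open Collapse em (ordinal Λ) (h t₀) ⊏-wellFounded ⊏-connex ⊏-small
           Π/D (invariantCode Π/D code code-separates)

proposition2p1 : ∀ {ℓ : Level} → ExcludedMiddle ℓ →
    (κ θ Λ : Cardinal ℓ) → Infinite κ → Infinite θ → Infinite Λ →
    IsCofinality Λ θ →
    (D : Ultrafilter ⟨ κ ⟩) → WeaklyNormal θ D →
    Strong κ Λ →
    ∃ λ (Λs : ⟨ κ ⟩ → Cardinal ℓ) →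
    IsLimit D Λs Λ × (∣ Ultraproduct (λ i → ⟨ Λs i ⟩) D ∣≈ Λ)
proposition2p1 em κ θ Λ κ-infinite θ-infinite _ cof D wn strong = Λs , isLimit , Π/D-size
  where open Construction em κ θ Λ κ-infinite θ-infinite cof D wn strong
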